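{- Let $d : t\to_{\mathsf s}^* u$ be an $\mathsf s$-normalizing reduction sequence. Then there is a derivation $\Phi\triangleright\Gamma\vdash t:N$ with $\Gamma$ an inert type context, $N$ precisely solvable, and $2|d|_{\mathsf m}+|u|_{\mathsf s}=|\Phi|_{\mathsf m}$.
   Context: Value substitution calculus (VSC). Terms (the set $\Lambda_{\mathsf{vsc}}$) are $t,u,s ::= v \mid tu \mid t[x{\leftarrow}u]$ and values are $v ::= x \mid \lambda x.t$; $t[x{\leftarrow}u]$ is an explicit substitution (ES), binding $x$ in $t$. Terms are up to $\alpha$-renaming; $t\{x{\leftarrow}u\}$ is capture-avoiding substitution. Contexts are terms with exactly one hole $\langle\cdot\rangle$; plugging may capture. Substitution contexts: $L ::= \langle\cdot\rangle \mid L[x{\leftarrow}t]$. Root rules: $L\langle\lambda x.t\rangle u \mapsto_{\mathsf m} L\langle t[x{\leftarrow}u]\rangle$ and $t[x{\leftarrow}L\langle v\rangle] \mapsto_{\mathsf e} L\langle t\{x{\leftarrow}v\}\rangle$ with $v$ a value, where (by $\alpha$-renaming) $L$ captures no free variable of $u$, resp. of $t$. Open contexts: $O ::= \langle\cdot\rangle \mid Ot \mid tO \mid O[x{\leftarrow}t]\mid t[x{\leftarrow}O]$. Solving contexts: $S ::= O \mid \lambda x.S \mid St \mid S[x{\leftarrow}t]$. For $a\in\{\mathsf m,\mathsf e\}$, $\to_{\mathsf{s}a}$ is the closure of $\mapsto_a$ under solving contexts (open contexts included), and $\to_{\mathsf s} = \to_{\mathsf{sm}}\cup\to_{\mathsf{se}}$.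 A reduction sequence $d:t\to_{\mathsf s}^*u$ is $\mathsf s$-normalizing if $u$ is $\to_{\mathsf s}$-normal; $|d|_{\mathsf m}$ is the number of $\to_{\mathsf{sm}}$ steps in $d$. Sizes of terms. Open size: $|x|_{\mathsf o}=|\lambda x.t|_{\mathsf o}=0$, $|tu|_{\mathsf o}=|t|_{\mathsf o}+|u|_{\mathsf o}+1$, $|t[x{\leftarrow}u]|_{\mathsf o}=|t|_{\mathsf o}+|u|_{\mathsf o}$. Solvable size: $|x|_{\mathsf s}=0$, $|\lambda x.t|_{\mathsf s}=|t|_{\mathsf s}+1$, $|tu|_{\mathsf s}=|t|_{\mathsf s}+|u|_{\mathsf o}+1$, $|t[x{\leftarrow}u]|_{\mathsf s}=|t|_{\mathsf s}+|u|_{\mathsf o}$. Multi types. Linear types $A ::= X \mid M\multimap N$ ($X$ a fixed ground type) and multi types $M,N ::= [A_1,\dots,A_n]$, $n\ge 0$ (finite multisets). A type context $\Gamma$ is a total function from variables to multi types, equal to the empty multiset $\mathbf 0$ except on finitely many variables; $\uplus$ is multiset sum, extended pointwise to type contexts; $\Gamma, x:M$ denotes the extension of $\Gamma$ (with $\Gamma(x)=\mathbf 0$) mapping $x$ to $M$. Typing rules: - (ax) $x:[A]\vdash x:A$; - ($\lambda$) from $\Gamma,x:M\vdash t:N$ infer $\Gamma\vdash\lambda x.t:M\multimap N$; - (many) for a value $v$ and a finite (possibly empty) set $I$, from $\Gamma_i\vdash v:A_i$ for all $i\in I$ infer $\biguplus_{i\in I}\Gamma_i\vdash v:\biguplus_{i\in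 I}[A_i]$; - (@) from $\Gamma\vdash t:[M\multimap N]$ and $\Delta\vdash u:M$ infer $\Gamma\uplus\Delta\vdash tu:N$; - (es) from $\Gamma,x:M\vdash t:N$ and $\Delta\vdash u:M$ infer $\Gamma\uplus\Delta\vdash t[x{\leftarrow}u]:N$. $\Phi\triangleright\Gamma\vdash t:M$ means that $\Phi$ is a derivation with that conclusion ($M$ a multi type). $|\Phi|_{\mathsf m}$ is the number of occurrences of rules ($\lambda$) and (@) in $\Phi$. Kinds of types. - Inert: multi $M^{\mathsf i}::=[A^{\mathsf i}_1,\dots,A^{\mathsf i}_n]$, $n\ge0$; linear $A^{\mathsf i}::=X\mid n[X]\multimap M^{\mathsf i}$, where $n[X]$ is the multiset with $n\ge0$ copies of $X$. A type context is inert if it assigns only inert multi types. - Unitary solvable: multi $M^{us}::=[A^{us}]$; linear $A^{us}::=X\mid M\multimap M^{us}$ ($M$ any multi type). - Inertly solvable: multi $M^{is}::=[A^{is}_1,\dots,A^{is}_n]$, $n>0$; linear $A^{is}::=X\mid M^{\mathsf i}\multimap M^{is}$. - Precisely solvable: both unitary solvable and inertly solvable. -}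

module Defs where

open import Data.Fin.Base using (Fin; zero; suc)
open import Data.List.Base using (List; []; _∷_; [_]; _++_; length; map; foldr; replicate)
open import Data.List.Relation.Unary.All using (All; []; _∷_)
open import Data.List.Relation.Binary.Permutation.Homogeneous using (Permutation)
open import Data.Nat.Base using (ℕ; zero; suc; _+_; _<_)
open import Data.Product.Base using (_×_; _,_; proj₁; proj₂)
open import Data.Sum.Base using (inj₁; inj₂)
import Data.Vec.Functional as Vector
open import Data.Vec.Functional using (Vector)
open import Function.Base using (_∘_; id; const)
open import Level using (0ℓ)
open import Relation.Binary.Construct.Closure.ReflexiveTransitive using (Star; ε; _◅_)
open import Relation.Binary.Construct.Union using (_∪_)
open import Relation.Binary.Core using (Rel)

private
  variable
    n m k : ℕ

-- Terms are well-scoped de Bruijn terms: `Term n` has its free variables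
-- in `Fin n`, so α-equivalence is propositional equality.  In `ƛ t` and
-- `t [← u ]`, index `zero` of `t` is the bound variable.

infixl 7 _·_
infixl 8 _[←_]

mutual
  data Value (n : ℕ) : Set where
    var : Fin n → Value n
    ƛ_  : Term (suc n) → Value n

  data Term (n : ℕ) : Set where
    val   : Value n → Term n
    _·_   : Term n → Term n → Term n
    _[←_] : Term (suc n) → Term n → Term n

Renaming : ℕ → ℕ → Set
Renaming n m = Fin n → Fin m

liftʳ : Renaming n m → Renaming (suc n) (suc m)
liftʳ ρ zero    = zero
liftʳ ρ (suc x) = suc (ρ x)

mutual
  renameᵛ : Renaming n m → Value n → Value m
  renameᵛ ρ (var x) = var (ρ x)
  renameᵛ ρ (ƛ t)   = ƛ rename (liftʳ ρ) t

  rename : Renaming n m → Term n → Term m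
  rename ρ (val v)    = val (renameᵛ ρ v)
  rename ρ (t · u)    = rename ρ t · rename ρ u
  rename ρ (t [← u ]) = rename (liftʳ ρ) t [← rename ρ u ]

-- The calculus only ever substitutes values for variables.

Substitution : ℕ → ℕ → Set
Substitution n m = Fin n → Value m

liftˢ : Substitution n m → Substitution (suc n) (suc m)
liftˢ σ zero    = var zero
liftˢ σ (suc x) = renameᵛ suc (σ x)

mutual
  substᵛ : Substitution n m → Value n → Value m
  substᵛ σ (var x) = σ x
  substᵛ σ (ƛ t)   = ƛ subst (liftˢ σ) t

  subst : Substitution n m → Term n → Term m
  subst σ (val v)    = val (substᵛ σ v)
  subst σ (t · u)    = subst σ t · subst σ u
  subst σ (t [← u ]) = subst (liftˢ σ) t [← subst σ u ]

infixl 8 _❴_❵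

-- t ❴ v ❵ is t{x←v}, where x is index `zero` of t.
_❴_❵ : Term (suc n) → Value n → Term n
t ❴ v ❵ = subst (λ { zero → v ; (suc x) → var x }) t

-- A context in `XCtx n k` lives in scope n and has its hole in scope k;
-- the k - n additional variables are those captured by plugging.

data SubstCtx : ℕ → ℕ → Set where
  ∙     : SubstCtx n n
  _[←_] : SubstCtx (suc n) k → Term n → SubstCtx n k

infix 9 _⟨_⟩ᴸ _⟨_⟩ᴼ _⟨_⟩ˢ

_⟨_⟩ᴸ : SubstCtx n k → Term k → Term n
∙          ⟨ t ⟩ᴸ = t
(L [← u ]) ⟨ t ⟩ᴸ = (L ⟨ t ⟩ᴸ) [← u ]

-- Moves a variable from outside L into its hole, avoiding capture.
weaken : SubstCtx n k → Renaming n k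
weaken ∙          = id
weaken (L [← u ]) = weaken L ∘ suc

data OpenCtx : ℕ → ℕ → Set where
  ∙      : OpenCtx n n
  _·ˡ_   : OpenCtx n k → Term n → OpenCtx n k
  _·ʳ_   : Term n → OpenCtx n k → OpenCtx n k
  _[←_]ˡ : OpenCtx (suc n) k → Term n → OpenCtx n k
  _[←_]ʳ : Term (suc n) → OpenCtx n k → OpenCtx n k

_⟨_⟩ᴼ : OpenCtx n k → Term k → Term n
∙           ⟨ r ⟩ᴼ = r
(O ·ˡ t)    ⟨ r ⟩ᴼ = O ⟨ r ⟩ᴼ · t
(t ·ʳ O)    ⟨ r ⟩ᴼ = t · O ⟨ r ⟩ᴼ
(O [← t ]ˡ) ⟨ r ⟩ᴼ = (O ⟨ r ⟩ᴼ) [← t ]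
(t [← O ]ʳ) ⟨ r ⟩ᴼ = t [← O ⟨ r ⟩ᴼ ]

data SolvingCtx : ℕ → ℕ → Set where
  open′ : OpenCtx n k → SolvingCtx n k
  ƛ_    : SolvingCtx (suc n) k → SolvingCtx n k
  _·_   : SolvingCtx n k → Term n → SolvingCtx n k
  _[←_] : SolvingCtx (suc n) k → Term n → SolvingCtx n k

_⟨_⟩ˢ : SolvingCtx n k → Term k → Term n
(open′ O)  ⟨ r ⟩ˢ = O ⟨ r ⟩ᴼ
(ƛ S)      ⟨ r ⟩ˢ = val (ƛ (S ⟨ r ⟩ˢ))
(S · t)    ⟨ r ⟩ˢ = S ⟨ r ⟩ˢ · t
(S [← t ]) ⟨ r ⟩ˢ = (S ⟨ r ⟩ˢ) [← t ]

infix 4 _↦m_ _↦e_ _→sm_ _→se_ _→s_ _→s*_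

data _↦m_ {n : ℕ} : Rel (Term n) 0ℓ where
  root-m : (L : SubstCtx n k) (t : Term (suc k)) (u : Term n) →
           L ⟨ val (ƛ t) ⟩ᴸ · u ↦m L ⟨ t [← rename (weaken L) u ] ⟩ᴸ

data _↦e_ {n : ℕ} : Rel (Term n) 0ℓ where
  root-e : (t : Term (suc n)) (L : SubstCtx n k) (v : Value k) →
           t [← L ⟨ val v ⟩ᴸ ] ↦e L ⟨ rename (liftʳ (weaken L)) t ❴ v ❵ ⟩ᴸ

data SolvingClosure (R : ∀ {k} → Rel (Term k) 0ℓ) {n : ℕ} : Rel (Term n) 0ℓ where
  close : (S : SolvingCtx n k) {r r′ : Term k} → R r r′ →
          SolvingClosure R (S ⟨ r ⟩ˢ) (S ⟨ r′ ⟩ˢ)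

_→sm_ _→se_ _→s_ _→s*_ : Rel (Term n) 0ℓ
_→sm_ = SolvingClosure _↦m_
_→se_ = SolvingClosure _↦e_
_→s_  = _→sm_ ∪ _→se_
_→s*_ = Star _→s_

#m : {t u : Term n} → t →s* u → ℕ
#m ε            = 0
#m (inj₁ _ ◅ d) = suc (#m d)
#m (inj₂ _ ◅ d) = #m d

openSize : Term n → ℕ
openSize (val _)    = 0
openSize (t · u)    = openSize t + openSize u + 1
openSize (t [← u ]) = openSize t + openSize u

solvableSize : Term n → ℕ
solvableSize (val (var _)) = 0
solvableSize (val (ƛ t))   = solvableSize t + 1
solvableSize (t · u)       = solvableSize t + openSize u + 1
solvableSize (t [← u ])    = solvableSize t + openSize u

-- Finite multisets are represented by lists, and equality of linear and
-- multi types by _≈ˡ_ and _≈_: permutation, hereditarily at every nesting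
-- depth.

infixr 6 _⊸_
infix 4 _≈ˡ_ _≈_ _≈ᶜ_

mutual
  data Linear : Set where
    X   : Linear
    _⊸_ : Multi → Multi → Linear

  Multi : Set
  Multi = List Linear

mutual
  data _≈ˡ_ : Rel Linear 0ℓ where
    X   : X ≈ˡ X
    _⊸_ : ∀ {M M′ N N′} → M ≈ M′ → N ≈ N′ → (M ⊸ N) ≈ˡ (M′ ⊸ N′)

  _≈_ : Rel Multi 0ℓ
  _≈_ = Permutation _≈ˡ_

-- As a term in `Term n` has its free variables in `Fin n`, only these
-- variables can have a nonempty type in a derivation for it.
Ctx : ℕ → Set
Ctx n = Vector Multi n

_≈ᶜ_ : Rel (Ctx n) 0ℓ
Γ ≈ᶜ Δ = ∀ x → Γ x ≈ Δ x

∅ : Ctx n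
∅ = Vector.replicate _ []

infixl 6 _⊎_
_⊎_ : Ctx n → Ctx n → Ctx n
_⊎_ = Vector.zipWith _++_

⨄ : List (Ctx n) → Ctx n
⨄ = foldr _⊎_ ∅

infix 8 _↪_
_↪_ : Fin n → Multi → Ctx n
x ↪ M = Vector.updateAt ∅ x (const M)

infixl 5 _▸_
_▸_ : Ctx n → Multi → Ctx (suc n)
Γ ▸ M = M Vector.∷ Γ

-- The equations between multisets implicit in the conclusions of the rules
-- are explicit premises, up to _≈_; for _⊢ᵛ_∶_ and _⊢_∶_ this amounts to
-- working with types and contexts modulo _≈_.  In `many`, the index set I is
-- the set of positions of the list Js of pairs (Γᵢ , Aᵢ).

infix 3 _⊢ᵛ_∶_ _⊢_∶_

mutual
  data _⊢ᵛ_∶_ {n : ℕ} (Γ : Ctx n) : Value n → Linear → Set where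
    ax  : ∀ {x A} →
          Γ ≈ᶜ x ↪ [ A ] →
          Γ ⊢ᵛ var x ∶ A
    lam : ∀ {t M N} →
          Γ ▸ M ⊢ t ∶ N →
          Γ ⊢ᵛ ƛ t ∶ M ⊸ N

  data _⊢_∶_ {n : ℕ} (Γ : Ctx n) : Term n → Multi → Set where
    many : ∀ {v M} (Js : List (Ctx n × Linear)) →
           All (λ J → proj₁ J ⊢ᵛ v ∶ proj₂ J) Js →
           Γ ≈ᶜ ⨄ (map proj₁ Js) →
           M ≈ map proj₂ Js →
           Γ ⊢ val v ∶ M
    app  : ∀ {Γ₁ Γ₂ t u M N} →
           Γ₁ ⊢ t ∶ [ M ⊸ N ] →
           Γ₂ ⊢ u ∶ M →
           Γ ≈ᶜ Γ₁ ⊎ Γ₂ →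
           Γ ⊢ t · u ∶ N
    es   : ∀ {Γ₁ Γ₂ t u M N} →
           Γ₁ ▸ M ⊢ t ∶ N →
           Γ₂ ⊢ u ∶ M →
           Γ ≈ᶜ Γ₁ ⊎ Γ₂ →
           Γ ⊢ t [← u ] ∶ N

-- The number of occurrences of rules (λ) and (@).
mutual
  sizeᵛ : {Γ : Ctx n} {v : Value n} {A : Linear} → Γ ⊢ᵛ v ∶ A → ℕ
  sizeᵛ (ax _)  = 0
  sizeᵛ (lam Φ) = suc (size Φ)

  size : {Γ : Ctx n} {t : Term n} {M : Multi} → Γ ⊢ t ∶ M → ℕ
  size (many _ Φs _ _) = sizes Φs
  size (app Φ Ψ _)     = suc (size Φ + size Ψ)
  size (es Φ Ψ _)      = size Φ + size Ψ

  sizes : {v : Value n} {Js : List (Ctx n × Linear)} →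
          All (λ J → proj₁ J ⊢ᵛ v ∶ proj₂ J) Js → ℕ
  sizes []       = 0
  sizes (Φ ∷ Φs) = sizeᵛ Φ + sizes Φs

mutual
  data Inertˡ : Linear → Set where
    X   : Inertˡ X
    _⊸_ : ∀ k {M} → Inert M → Inertˡ (replicate k X ⊸ M)

  Inert : Multi → Set
  Inert = All Inertˡ

InertCtx : Ctx n → Set
InertCtx Γ = ∀ x → Inert (Γ x)

mutual
  data UnitarySolvableˡ : Linear → Set where
    X   : UnitarySolvableˡ X
    _⊸_ : ∀ M {N} → UnitarySolvable N → UnitarySolvableˡ (M ⊸ N)

  data UnitarySolvable : Multi → Set where
    single : ∀ {A} → UnitarySolvableˡ A → UnitarySolvable [ A ]

mutual
  data InertlySolvableˡ : Linear → Set where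
    X   : InertlySolvableˡ X
    _⊸_ : ∀ {M N} → Inert M → InertlySolvable N → InertlySolvableˡ (M ⊸ N)

  InertlySolvable : Multi → Set
  InertlySolvable M = 0 < length M × All InertlySolvableˡ M

PreciselySolvable : Multi → Set
PreciselySolvable M = UnitarySolvable M × InertlySolvable M

{-# OPTIONS --safe #-}
module Submission where

-- Typing is reflected by s-steps: an m-step contracts one (@) and one (λ) and an e-step neither, so
-- a derivation for the reduct gives one for the redex with the same conclusion and 2, resp. 0, more
-- such rules.  Steps under an abstraction are counted once because unitary solvable types make
-- `many` unary there.  It remains to type normal forms.  An open normal form is either an answer
-- L⟨λx.s⟩, which has the empty type, or neutral, and then it has every inert type, with as many
-- rules as its open size; the arguments and substituted terms of a normal form are typed this way.

open import Defs
open import Data.Nat.Base using (ℕ; _+_; _*_)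
open import Data.Product.Base using (_×_; Σ-syntax)
open import Relation.Binary.PropositionalEquality.Core using (_≡_)
open import Relation.Binary.Rewriting using (IsNormalForm)

open import Algebra.Bundles using (CommutativeMonoid)
import Algebra.Construct.Pointwise as Pointwise
import Algebra.Properties.CommutativeSemigroup as CommutativeSemigroupProperties
open import Data.Empty using (⊥-elim)
open import Data.Fin.Base using (Fin; zero; suc)
open import Data.Fin.Properties using (_≟_; suc-injective)
open import Data.List.Base using ([]; _∷_; [_]; _++_; map)
import Data.List.Relation.Binary.Permutation.Homogeneous as Permutation
import Data.List.Relation.Binary.Permutation.Setoid.Properties as PermutationProperties
open import Data.List.Relation.Binary.Pointwise.Base using (Pointwise; []; _∷_)
open import Data.List.Relation.Unary.All using (All; []; _∷_)
import Data.List.Relation.Unary.All.Properties as All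
open import Data.Nat.Base using (zero; suc; z<s)
open import Data.Nat.Properties
  using (+-identityʳ; +-suc; +-comm; +-assoc; +-0-commutativeMonoid; *-suc)
open import Data.Nat.Solver using (module +-*-Solver)
open import Data.Product.Base using (∃; ∃₂; _,_; proj₁; proj₂)
open import Data.Sum.Base using (inj₁; inj₂) renaming (_⊎_ to _or_)
open import Data.Vec.Functional.Properties using (updateAt-updates; updateAt-minimal)
open import Function.Base using (_∘_)
open import Function.Definitions using (Injective)
open import Level using (0ℓ)
open import Relation.Binary.Bundles using (Setoid)
open import Relation.Binary.Construct.Closure.ReflexiveTransitive using (ε; _◅_)
open import Relation.Binary.PropositionalEquality.Core using (_≢_; refl; sym; trans; cong; cong₂)
open import Relation.Nullary using (¬_; yes; no)

private
  variable
    m n j k : ℕ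
    M N : Multi
    A : Linear
    v : Value n
    Γ Γ₁ Γ₂ Γ′ Δ : Ctx n

-- Equality of types

mutual
  ≈ˡ-refl : ∀ {A} → A ≈ˡ A
  ≈ˡ-refl {X}     = X
  ≈ˡ-refl {M ⊸ N} = Permutation.refl ≋-refl ⊸ Permutation.refl ≋-refl

  ≋-refl : ∀ {M} → Pointwise _≈ˡ_ M M
  ≋-refl {[]}    = []
  ≋-refl {A ∷ M} = ≈ˡ-refl ∷ ≋-refl

mutual
  ≈ˡ-sym : ∀ {A B} → A ≈ˡ B → B ≈ˡ A
  ≈ˡ-sym X       = X
  ≈ˡ-sym (p ⊸ q) = ≈-sym p ⊸ ≈-sym q

  ≋-sym : ∀ {M N} → Pointwise _≈ˡ_ M N → Pointwise _≈ˡ_ N M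
  ≋-sym []       = []
  ≋-sym (p ∷ ps) = ≈ˡ-sym p ∷ ≋-sym ps

  ≈-sym : ∀ {M N} → M ≈ N → N ≈ M
  ≈-sym (Permutation.refl ps)    = Permutation.refl (≋-sym ps)
  ≈-sym (Permutation.prep e p)   = Permutation.prep (≈ˡ-sym e) (≈-sym p)
  ≈-sym (Permutation.swap e f p) = Permutation.swap (≈ˡ-sym f) (≈ˡ-sym e) (≈-sym p)
  ≈-sym (Permutation.trans p q)  = Permutation.trans (≈-sym q) (≈-sym p)

≈ˡ-trans : ∀ {A B C} → A ≈ˡ B → B ≈ˡ C → A ≈ˡ C
≈ˡ-trans X       X         = X
≈ˡ-trans (p ⊸ q) (p′ ⊸ q′) = Permutation.trans p p′ ⊸ Permutation.trans q q′

linear-setoid : Setoid 0ℓ 0ℓ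
linear-setoid = record
  { _≈_           = _≈ˡ_
  ; isEquivalence = record { refl = ≈ˡ-refl ; sym = ≈ˡ-sym ; trans = ≈ˡ-trans }
  }

multi-commutativeMonoid : CommutativeMonoid 0ℓ 0ℓ
multi-commutativeMonoid = PermutationProperties.++-commutativeMonoid linear-setoid

ctx-commutativeMonoid : ℕ → CommutativeMonoid 0ℓ 0ℓ
ctx-commutativeMonoid n = Pointwise.commutativeMonoid (Fin n) multi-commutativeMonoid

module ≈ = CommutativeMonoid multi-commutativeMonoid
module ≈ᶜ {n : ℕ} where
  open CommutativeMonoid (ctx-commutativeMonoid n) public
  open CommutativeSemigroupProperties commutativeSemigroup public

open CommutativeSemigroupProperties (CommutativeMonoid.commutativeSemigroup +-0-commutativeMonoid)
  using (x∙yz≈y∙xz) renaming (interchange to +-interchange)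

-- Contexts with at most one nonempty type

↪-self : (x : Fin n) → (x ↪ M) x ≡ M
↪-self x = updateAt-updates x ∅

↪-other : {x y : Fin n} → y ≢ x → (x ↪ M) y ≡ []
↪-other {x = x} {y} = updateAt-minimal y x ∅

↪-[] : (x : Fin n) → x ↪ [] ≈ᶜ ∅
↪-[] zero    zero    = ≈.refl
↪-[] zero    (suc y) = ≈.refl
↪-[] (suc x) zero    = ≈.refl
↪-[] (suc x) (suc y) = ↪-[] x y

↪-++ : (x : Fin n) (M N : Multi) → x ↪ (M ++ N) ≈ᶜ x ↪ M ⊎ x ↪ N
↪-++ zero    M N zero    = ≈.refl
↪-++ zero    M N (suc y) = ≈.refl
↪-++ (suc x) M N zero    = ≈.refl
↪-++ (suc x) M N (suc y) = ↪-++ x M N y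

↪-cong : (x : Fin n) → M ≈ N → x ↪ M ≈ᶜ x ↪ N
↪-cong zero    e zero    = e
↪-cong zero    e (suc y) = ≈.refl
↪-cong (suc x) e zero    = ≈.refl
↪-cong (suc x) e (suc y) = ↪-cong x e y

↪-injective : {ρ : Renaming n m} → Injective _≡_ _≡_ ρ → (x : Fin n) (M : Multi) →
              (ρ x ↪ M) ∘ ρ ≈ᶜ x ↪ M
↪-injective {ρ = ρ} inj x M y with y ≟ x
... | yes refl = ≈.reflexive (trans (↪-self (ρ x)) (sym (↪-self x)))
... | no y≢x   = ≈.reflexive (trans (↪-other (y≢x ∘ inj)) (sym (↪-other y≢x)))

-- Sized typing

infix 3 _⊢ᵛ_∶_#_ _⊢_∶_#_

-- With the size as an index, each lemma transforms a derivation and accounts for its rules at once.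
_⊢ᵛ_∶_#_ : Ctx n → Value n → Linear → ℕ → Set
Γ ⊢ᵛ v ∶ A # k = Σ[ Φ ∈ Γ ⊢ᵛ v ∶ A ] sizeᵛ Φ ≡ k

_⊢_∶_#_ : Ctx n → Term n → Multi → ℕ → Set
Γ ⊢ t ∶ M # k = Σ[ Φ ∈ Γ ⊢ t ∶ M ] size Φ ≡ k

-- The equations of the last rule absorb a change of context. A change of type is pushed through (@)
-- and (es) into their left premises until a (many) absorbs it.
conv : ∀ {t : Term n} → Γ ≈ᶜ Δ → M ≈ N → Γ ⊢ t ∶ M # k → Δ ⊢ t ∶ N # k
conv e f (many Js Φs Γ≈ M≈ , s) =
  many Js Φs (≈ᶜ.trans (≈ᶜ.sym e) Γ≈) (≈.trans (≈.sym f) M≈) , s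
conv e f (app Φ Ψ Γ≈ , refl) =
  let Φ′ , s = conv ≈ᶜ.refl (Permutation.prep (≈.refl ⊸ f) ≈.refl) (Φ , refl)
  in  app Φ′ Ψ (≈ᶜ.trans (≈ᶜ.sym e) Γ≈) , cong (λ s → suc (s + size Ψ)) s
conv e f (es Φ Ψ Γ≈ , refl) =
  let Φ′ , s = conv ≈ᶜ.refl f (Φ , refl)
  in  es Φ′ Ψ (≈ᶜ.trans (≈ᶜ.sym e) Γ≈) , cong (_+ size Ψ) s

resize : ∀ {t : Term n} → j ≡ k → Γ ⊢ t ∶ M # j → Γ ⊢ t ∶ M # k
resize e (Φ , s) = Φ , trans s e

uncons# : ∀ {t} → Γ zero ≈ M → Γ ⊢ t ∶ N # k → Γ ∘ suc ▸ M ⊢ t ∶ N # k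
uncons# e = conv (λ { zero → e ; (suc x) → ≈.refl }) ≈.refl

app# : ∀ {t u : Term n} → Γ ≈ᶜ Γ₁ ⊎ Γ₂ →
       Γ₁ ⊢ t ∶ [ M ⊸ N ] # j → Γ₂ ⊢ u ∶ M # k → Γ ⊢ t · u ∶ N # suc (j + k)
app# e (Φ , refl) (Ψ , refl) = app Φ Ψ e , refl

es# : ∀ {t u} → Γ ≈ᶜ Γ₁ ⊎ Γ₂ →
      Γ₁ ▸ M ⊢ t ∶ N # j → Γ₂ ⊢ u ∶ M # k → Γ ⊢ t [← u ] ∶ N # (j + k)
es# e (Φ , refl) (Ψ , refl) = es Φ Ψ e , refl

lam# : ∀ {t} → Γ ▸ M ⊢ t ∶ N # k → Γ ⊢ᵛ ƛ t ∶ M ⊸ N # suc k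
lam# (Φ , refl) = lam Φ , refl

-- `nil#` and `cons#` build (many) one premise at a time, so that proofs about values can recurse
-- over the list of premises.
nil# : Γ ≈ᶜ ∅ → Γ ⊢ val v ∶ [] # 0
nil# e = many [] [] e ≈.refl , refl

cons# : Γ₁ ⊢ᵛ v ∶ A # j → Γ₂ ⊢ val v ∶ M # k → Γ₁ ⊎ Γ₂ ⊢ val v ∶ A ∷ M # (j + k)
cons# {Γ₁ = Γ₁} {A = A} (Φ , refl) (many Js Φs Γ≈ M≈ , refl) =
  many ((Γ₁ , A) ∷ Js) (Φ ∷ Φs) (≈ᶜ.∙-cong {x = Γ₁} ≈ᶜ.refl Γ≈) (Permutation.prep ≈ˡ-refl M≈) , refl

single# : Γ ⊢ᵛ v ∶ A # k → Γ ⊢ val v ∶ [ A ] # k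
single# {Γ = Γ} {k = k} Φ =
  conv (≈ᶜ.identityʳ Γ) ≈.refl (resize (+-identityʳ k) (cons# Φ (nil# ≈ᶜ.refl)))

++# : Γ₁ ⊢ val v ∶ M # j → Γ₂ ⊢ val v ∶ N # k → Γ₁ ⊎ Γ₂ ⊢ val v ∶ M ++ N # (j + k)
++# {v = v} {Γ₂ = Γ₂} {N = N} {k = k} (many Js Φs Γ≈ M≈ , refl) Ψ =
  conv (≈ᶜ.∙-congʳ {x = Γ₂} (≈ᶜ.sym Γ≈)) (≈.∙-congʳ {N} (≈.sym M≈)) (all Φs)
  where
  all : ∀ {Js} (Φs : All (λ J → proj₁ J ⊢ᵛ v ∶ proj₂ J) Js) →
        ⨄ (map proj₁ Js) ⊎ Γ₂ ⊢ val v ∶ map proj₂ Js ++ N # (sizes Φs + k)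
  all []                          = Ψ
  all {(Γ , A) ∷ Js} (Φ ∷ Φs) =
    conv (≈ᶜ.sym (≈ᶜ.assoc Γ (⨄ (map proj₁ Js)) Γ₂)) ≈.refl
      (resize (sym (+-assoc (sizeᵛ Φ) (sizes Φs) k)) (cons# (Φ , refl) (all Φs)))

var# : (x : Fin n) (M : Multi) → x ↪ M ⊢ val (var x) ∶ M # 0
var# x []      = nil# (↪-[] x)
var# x (A ∷ M) =
  conv (≈ᶜ.sym (↪-++ x [ A ] M)) ≈.refl (cons# (ax ≈ᶜ.refl , refl) (var# x M))

var-inversion : {x : Fin n} → Γ ⊢ val (var x) ∶ M # k → Γ ≈ᶜ x ↪ M × k ≡ 0
var-inversion {x = x} (many Js Φs Γ≈ M≈ , refl) =
  let e , s = all Φs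
  in  ≈ᶜ.trans Γ≈ (≈ᶜ.trans e (↪-cong x (≈.sym M≈))) , s
  where
  all : ∀ {Js} (Φs : All (λ J → proj₁ J ⊢ᵛ var x ∶ proj₂ J) Js) →
        ⨄ (map proj₁ Js) ≈ᶜ x ↪ map proj₂ Js × sizes Φs ≡ 0
  all [] = ≈ᶜ.sym (↪-[] x) , refl
  all {(_ , A) ∷ Js} (ax e ∷ Φs) =
    let e′ , s = all Φs
    in  ≈ᶜ.trans (≈ᶜ.∙-cong e e′) (≈ᶜ.sym (↪-++ x [ A ] (map proj₂ Js))) , s

-- Renaming

liftʳ-injective : {ρ : Renaming n m} → Injective _≡_ _≡_ ρ → Injective _≡_ _≡_ (liftʳ ρ)
liftʳ-injective inj {zero}  {zero}  _ = refl
liftʳ-injective inj {suc x} {suc y} e = cong suc (inj (suc-injective e))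

weaken-injective : (L : SubstCtx n k) → Injective _≡_ _≡_ (weaken L)
weaken-injective ∙          e = e
weaken-injective (L [← u ]) e = suc-injective (weaken-injective L e)

mutual
  -- Injectivity makes an (ax) survive the pullback, as only `x` is mapped to `ρ x`. Expansion uses
  -- this to undo the weakening of `t` and `u` in the root rules.
  unrenameᵛ : (v : Value n) {ρ : Renaming n m} → Injective _≡_ _≡_ ρ →
              Δ ⊢ᵛ renameᵛ ρ v ∶ A # k → Δ ∘ ρ ⊢ᵛ v ∶ A # k
  unrenameᵛ (var x) {ρ} inj (ax {A = A} e , s) =
    ax (≈ᶜ.trans (e ∘ ρ) (↪-injective inj x [ A ])) , s
  unrenameᵛ (ƛ t) {ρ} inj (lam Φ , refl) =
    lam# (uncons# ≈.refl (unrename t (liftʳ-injective inj) (Φ , refl)))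

  unrename : (t : Term n) {ρ : Renaming n m} → Injective _≡_ _≡_ ρ →
             Δ ⊢ rename ρ t ∶ M # k → Δ ∘ ρ ⊢ t ∶ M # k
  unrename (val v) {ρ} inj (many Js Φs Γ≈ M≈ , refl) =
    conv (≈ᶜ.sym (Γ≈ ∘ ρ)) (≈.sym M≈) (unrenames v inj Φs)
  unrename (t · u) {ρ} inj (app Φ Ψ e , refl) =
    app# (e ∘ ρ) (unrename t inj (Φ , refl)) (unrename u inj (Ψ , refl))
  unrename (t [← u ]) {ρ} inj (es Φ Ψ e , refl) =
    es# (e ∘ ρ)
      (uncons# ≈.refl (unrename t (liftʳ-injective inj) (Φ , refl)))
      (unrename u inj (Ψ , refl))

  unrenames : (v : Value n) {ρ : Renaming n m} → Injective _≡_ _≡_ ρ → ∀ {Js} →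
              (Φs : All (λ J → proj₁ J ⊢ᵛ renameᵛ ρ v ∶ proj₂ J) Js) →
              ⨄ (map proj₁ Js) ∘ ρ ⊢ val v ∶ map proj₂ Js # sizes Φs
  unrenames v inj []       = nil# ≈ᶜ.refl
  unrenames v inj (Φ ∷ Φs) = cons# (unrenameᵛ v inj (Φ , refl)) (unrenames v inj Φs)

-- For `ρ = weaken L` this is the typing counterpart of the side condition that `L` captures no free
-- variable of the term moved into it.
SupportedBy : Renaming n m → Ctx m → Set
SupportedBy ρ Δ = ∀ y → (∀ x → ρ x ≢ y) → Δ y ≈ []

liftʳ-avoids : {ρ : Renaming n m} {y : Fin m} → (∀ x → ρ x ≢ y) → ∀ x → liftʳ ρ x ≢ suc y
liftʳ-avoids avoids (suc x) e = avoids x (suc-injective e)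

++-empty : ∀ {M₁ M₂} → M₁ ≈ [] → M₂ ≈ [] → M₁ ++ M₂ ≈ []
++-empty = ≈.∙-cong

mutual
  rename-supportᵛ : (v : Value n) {ρ : Renaming n m} → Δ ⊢ᵛ renameᵛ ρ v ∶ A → SupportedBy ρ Δ
  rename-supportᵛ (var x) (ax e) y avoids =
    ≈.trans (e y) (≈.reflexive (↪-other (avoids x ∘ sym)))
  rename-supportᵛ (ƛ t) (lam Φ) y avoids = rename-support t Φ (suc y) (liftʳ-avoids avoids)

  rename-support : (t : Term n) {ρ : Renaming n m} → Δ ⊢ rename ρ t ∶ M → SupportedBy ρ Δ
  rename-support (val v) (many Js Φs Γ≈ _) y avoids =
    ≈.trans (Γ≈ y) (rename-supports v Φs y avoids)
  rename-support (t · u) (app Φ Ψ e) y avoids =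
    ≈.trans (e y) (++-empty (rename-support t Φ y avoids) (rename-support u Ψ y avoids))
  rename-support (t [← u ]) (es Φ Ψ e) y avoids =
    ≈.trans (e y) (++-empty (rename-support t Φ (suc y) (liftʳ-avoids avoids))
                            (rename-support u Ψ y avoids))

  rename-supports : (v : Value n) {ρ : Renaming n m} → ∀ {Js} →
                    All (λ J → proj₁ J ⊢ᵛ renameᵛ ρ v ∶ proj₂ J) Js →
                    SupportedBy ρ (⨄ (map proj₁ Js))
  rename-supports v []       y avoids = ≈.refl
  rename-supports v (Φ ∷ Φs) y avoids =
    ++-empty (rename-supportᵛ v Φ y avoids) (rename-supports v Φs y avoids)

-- Substitution

infix 3 _⊢ˢ_∶_#_
infix 4 _∷_∣_

-- Δ is the sum over all x of contexts typing σ x with the multi type Γ x.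
data _⊢ˢ_∶_#_ {m : ℕ} (Δ : Ctx m) : {n : ℕ} → Substitution n m → Ctx n → ℕ → Set where
  [] : {σ : Substitution 0 m} {Γ : Ctx 0} →
       Δ ≈ᶜ ∅ →
       Δ ⊢ˢ σ ∶ Γ # 0
  _∷_∣_ : {σ : Substitution (suc n) m} {Γ : Ctx (suc n)} {Δ₁ Δ₂ : Ctx m} →
          Δ₁ ⊢ val (σ zero) ∶ Γ zero # j →
          Δ₂ ⊢ˢ σ ∘ suc ∶ Γ ∘ suc # k →
          Δ ≈ᶜ Δ₁ ⊎ Δ₂ →
          Δ ⊢ˢ σ ∶ Γ # (j + k)

private
  variable
    Δ₁ Δ₂ Δ′ : Ctx m
    σ : Substitution n m

convˢ : Δ ≈ᶜ Δ′ → Γ ≈ᶜ Γ′ → Δ ⊢ˢ σ ∶ Γ # k → Δ′ ⊢ˢ σ ∶ Γ′ # k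
convˢ e f ([] Δ≈)     = [] (≈ᶜ.trans (≈ᶜ.sym e) Δ≈)
convˢ e f (Φ ∷ Σ ∣ Δ≈) =
  conv ≈ᶜ.refl (f zero) Φ ∷ convˢ ≈ᶜ.refl (f ∘ suc) Σ ∣ ≈ᶜ.trans (≈ᶜ.sym e) Δ≈

resizeˢ : j ≡ k → Δ ⊢ˢ σ ∶ Γ # j → Δ ⊢ˢ σ ∶ Γ # k
resizeˢ refl Σ = Σ

∅ˢ : {σ : Substitution n m} → ∅ ⊢ˢ σ ∶ ∅ # 0
∅ˢ {n = zero}  = [] ≈ᶜ.refl
∅ˢ {n = suc n} = nil# ≈ᶜ.refl ∷ ∅ˢ ∣ ≈ᶜ.refl

⊎ˢ : Δ₁ ⊢ˢ σ ∶ Γ₁ # j → Δ₂ ⊢ˢ σ ∶ Γ₂ # k → Δ₁ ⊎ Δ₂ ⊢ˢ σ ∶ Γ₁ ⊎ Γ₂ # (j + k)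
⊎ˢ ([] e) ([] e′) = [] (≈ᶜ.∙-cong e e′)
⊎ˢ (_∷_∣_ {j = j} {k} {Δ₁ = Δ₁} {Δ₂} Φ Σ e) (_∷_∣_ {j = j′} {k′} {Δ₁ = Δ₁′} {Δ₂′} Φ′ Σ′ e′) =
  resizeˢ (+-interchange j j′ k k′)
    (++# Φ Φ′ ∷ ⊎ˢ Σ Σ′ ∣ ≈ᶜ.trans (≈ᶜ.∙-cong e e′) (≈ᶜ.interchange Δ₁ Δ₂ Δ₁′ Δ₂′))

↪ˢ : (x : Fin n) {σ : Substitution n m} → Δ ⊢ val (σ x) ∶ M # k → Δ ⊢ˢ σ ∶ x ↪ M # k
↪ˢ {Δ = Δ} {k = k} zero Φ =
  resizeˢ (+-identityʳ k) (Φ ∷ ∅ˢ ∣ ≈ᶜ.sym (≈ᶜ.identityʳ Δ))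
↪ˢ (suc x) Φ = nil# ≈ᶜ.refl ∷ ↪ˢ x Φ ∣ ≈ᶜ.refl

unrenameˢ : Δ ⊢ˢ renameᵛ suc ∘ σ ∶ Γ # k → Δ zero ≈ [] × (Δ ∘ suc ⊢ˢ σ ∶ Γ # k)
unrenameˢ ([] e) = e zero , [] (e ∘ suc)
unrenameˢ {σ = σ} (Φ ∷ Σ ∣ e) =
  let e₀ , Σ′ = unrenameˢ Σ
  in  ≈.trans (e zero) (++-empty (rename-support (val (σ zero)) (proj₁ Φ) zero (λ _ ())) e₀)
   , (unrename (val (σ zero)) suc-injective Φ ∷ Σ′ ∣ e ∘ suc)

-- The entry `var zero` contributes exactly `Γ zero`, at size 0; the other entries are weakened and
-- contribute nothing at `zero`. Hence the type of a bound variable is recovered when leaving its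
-- binder.
unliftˢ : Δ ⊢ˢ liftˢ σ ∶ Γ # k → Δ zero ≈ Γ zero × (Δ ∘ suc ⊢ˢ σ ∶ Γ ∘ suc # k)
unliftˢ {Γ = Γ} (Φ ∷ Σ ∣ e) with var-inversion Φ
... | e₁ , refl =
  let e₀ , Σ′ = unrenameˢ Σ
  in  ≈.trans (e zero) (≈.trans (≈.∙-cong (e₁ zero) e₀) (≈.identityʳ (Γ zero)))
   , convˢ (λ x → ≈.sym (≈.trans (e (suc x)) (≈.∙-congʳ (e₁ (suc x))))) ≈ᶜ.refl Σ′

idˢ-inversion : Δ ⊢ˢ var ∶ Γ # k → Δ ≈ᶜ Γ × k ≡ 0
idˢ-inversion ([] e)      = (λ ()) , refl
idˢ-inversion {Γ = Γ} (Φ ∷ Σ ∣ e) =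
  -- `var` and `liftˢ var` are not convertible, but they agree at `zero` and after `suc`, so the
  -- same components also type `liftˢ var`.
  let e₀ , Σ′ = unliftˢ {Γ = Γ} (Φ ∷ Σ ∣ e)
      e₁ , s  = idˢ-inversion Σ′
  in  (λ { zero → e₀ ; (suc x) → e₁ x }) , s

-- `P` is the judgement on the expression before substitution, so that one statement covers values,
-- terms and lists of premises.
Unsubst : Substitution n m → Ctx m → (Ctx n → ℕ → Set) → ℕ → Set
Unsubst σ Δ P s = ∃ λ Γ → ∃₂ λ j k → P Γ j × (Δ ⊢ˢ σ ∶ Γ # k) × s ≡ j + k

mutual
  -- At a variable the whole derivation moves to the substitution and an (ax) of size 0 stays
  -- behind. Derivations collected for the same variable are merged by `++#`, which is possible
  -- because its image is a value.
  unsubstᵛ : (v : Value n) {σ : Substitution n m} (Φ : Δ ⊢ᵛ substᵛ σ v ∶ A) →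
             Unsubst σ Δ (λ Γ j → Γ ⊢ᵛ v ∶ A # j) (sizeᵛ Φ)
  unsubstᵛ {A = A} (var x) Φ =
    x ↪ [ A ] , 0 , _ , (ax ≈ᶜ.refl , refl) , ↪ˢ x (single# (Φ , refl)) , refl
  unsubstᵛ (ƛ t) (lam Φ) =
    let Γ , j , k , Φ′ , Σ , s = unsubst t Φ
        e , Σ′ = unliftˢ Σ
    in  Γ ∘ suc , suc j , k
     , lam# (uncons# (≈.sym e) Φ′) , Σ′ , cong suc s

  unsubst : (t : Term n) {σ : Substitution n m} (Φ : Δ ⊢ subst σ t ∶ M) →
            Unsubst σ Δ (λ Γ j → Γ ⊢ t ∶ M # j) (size Φ)
  unsubst (val v) (many Js Φs Δ≈ M≈) =
    let Γ , j , k , Φ′ , Σ , s = unsubsts v Φs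
    in  Γ , j , k , conv ≈ᶜ.refl (≈.sym M≈) Φ′ , convˢ (≈ᶜ.sym Δ≈) ≈ᶜ.refl Σ , s
  unsubst (t · u) (app Φ Ψ Δ≈) =
    let Γ₁ , j₁ , k₁ , Φ′ , Σ₁ , s₁ = unsubst t Φ
        Γ₂ , j₂ , k₂ , Ψ′ , Σ₂ , s₂ = unsubst u Ψ
    in  Γ₁ ⊎ Γ₂ , suc (j₁ + j₂) , k₁ + k₂
     , app# ≈ᶜ.refl Φ′ Ψ′ , convˢ (≈ᶜ.sym Δ≈) ≈ᶜ.refl (⊎ˢ Σ₁ Σ₂)
     , cong suc (trans (cong₂ _+_ s₁ s₂) (+-interchange j₁ k₁ j₂ k₂))
  unsubst (t [← u ]) (es Φ Ψ Δ≈) =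
    let Γ₁ , j₁ , k₁ , Φ′ , Σ₁ , s₁ = unsubst t Φ
        Γ₂ , j₂ , k₂ , Ψ′ , Σ₂ , s₂ = unsubst u Ψ
        e , Σ₁′ = unliftˢ Σ₁
    in  Γ₁ ∘ suc ⊎ Γ₂ , j₁ + j₂ , k₁ + k₂
     , es# ≈ᶜ.refl (uncons# (≈.sym e) Φ′) Ψ′
     , convˢ (≈ᶜ.sym Δ≈) ≈ᶜ.refl (⊎ˢ Σ₁′ Σ₂)
     , trans (cong₂ _+_ s₁ s₂) (+-interchange j₁ k₁ j₂ k₂)

  unsubsts : (v : Value n) {σ : Substitution n m} → ∀ {Js} →
             (Φs : All (λ J → proj₁ J ⊢ᵛ substᵛ σ v ∶ proj₂ J) Js) →
             Unsubst σ (⨄ (map proj₁ Js)) (λ Γ j → Γ ⊢ val v ∶ map proj₂ Js # j) (sizes Φs)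
  unsubsts v []       = ∅ , 0 , 0 , nil# ≈ᶜ.refl , ∅ˢ , refl
  unsubsts v (Φ ∷ Φs) =
    let Γ₁ , j₁ , k₁ , Φ′ , Σ₁ , s₁ = unsubstᵛ v Φ
        Γ₂ , j₂ , k₂ , Ψ′ , Σ₂ , s₂ = unsubsts v Φs
    in  Γ₁ ⊎ Γ₂ , j₁ + j₂ , k₁ + k₂ , cons# Φ′ Ψ′ , ⊎ˢ Σ₁ Σ₂
     , trans (cong₂ _+_ s₁ s₂) (+-interchange j₁ k₁ j₂ k₂)

-- Subject expansion

-- The part Δ₂ of the typing of the hole that avoids the variables bound by L can be moved out of L.
Refill : SubstCtx n k → Ctx n → Ctx k → ℕ → Set
Refill {n} {k} L Γ Δ s = ∀ {Δ₁ Δ₂ t M j} → Δ ≈ᶜ Δ₁ ⊎ Δ₂ → SupportedBy (weaken L) Δ₂ →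
  Δ₁ ⊢ t ∶ M # j → ∃ λ Γ′ → Γ ≈ᶜ Γ′ ⊎ Δ₂ ∘ weaken L × (Γ′ ⊢ L ⟨ t ⟩ᴸ ∶ M # (j + s))

-- Each (es) along `L` passes the type of the hole on unchanged, so these rules can be rebuilt
-- around another term of another type; `s` adds up the sizes of their right premises.
unplug : (L : SubstCtx n k) {t : Term k} (Φ : Γ ⊢ L ⟨ t ⟩ᴸ ∶ N) →
         ∃₂ λ Δ s → Σ[ Ψ ∈ Δ ⊢ t ∶ N ] (size Φ ≡ size Ψ + s × Refill L Γ Δ s)
unplug {Γ = Γ} ∙ Φ = Γ , 0 , Φ , sym (+-identityʳ (size Φ)) , λ e _ Ψ →
  _ , e , resize (sym (+-identityʳ _)) Ψ
unplug {Γ = Γ} (L [← w ]) (es {Γ₁ = Γ₁} {Γ₂ = Γ₂} Φ Φw e) with unplug L Φ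
... | Δ , s , Ψ , Φ≡ , refill =
  Δ , s + size Φw , Ψ , trans (cong (_+ size Φw) Φ≡) (+-assoc (size Ψ) s (size Φw)) , refill′
  where
  refill′ : Refill (L [← w ]) Γ Δ (s + size Φw)
  refill′ {Δ₂ = Δ₂} {j = j} Δ≈ supported Ψ′ =
    let Γ′ , e′ , Φ′ = refill Δ≈ (λ y avoids → supported y (avoids ∘ suc)) Ψ′
        -- `weaken L zero` is the variable bound to `w`, as seen from the hole. No outer variable is
        -- sent there, so moving `Δ₂` out leaves the type required of `w` intact.
        Δ₂-empty = supported (weaken L zero) (λ x eq → 0≢suc (weaken-injective L eq))
        M≈ = ≈.trans (e′ zero) (≈.trans (≈.∙-congˡ {Γ′ zero} Δ₂-empty) (≈.identityʳ (Γ′ zero)))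
    in  Γ′ ∘ suc ⊎ Γ₂
     , ≈ᶜ.trans e (≈ᶜ.trans (≈ᶜ.∙-congʳ {x = Γ₂} (e′ ∘ suc))
                            (≈ᶜ.xy∙z≈xz∙y (Γ′ ∘ suc) (Δ₂ ∘ weaken L ∘ suc) Γ₂))
     , resize (+-assoc j s (size Φw))
         (es# ≈ᶜ.refl (uncons# (≈.sym M≈) Φ′) (Φw , refl))
    where
    0≢suc : {x : Fin n} → suc x ≢ zero
    0≢suc ()

Expands : ℕ → Term n → Term n → Set
Expands c r r′ = ∀ {Γ N} (Φ : Γ ⊢ r′ ∶ N) → Γ ⊢ r ∶ N # (c + size Φ)

expand-m : {r r′ : Term n} → r ↦m r′ → Expands 2 r r′
expand-m (root-m L t u) Φ with unplug L Φ
... | Δ , s , es Φt Φu e , Φ≡ , refill =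
  -- Only the abstraction stays inside `L`. The weakened `u` has a context supported by `weaken L`,
  -- so its part can leave.
  let Γ′ , e′ , Φ′ = refill e (rename-support u Φu) (single# (lam# (Φt , refl)))
  in  resize (trans (solve 3 (λ a b s → con 1 :+ ((con 1 :+ a) :+ s :+ b) :=
                                        con 2 :+ ((a :+ b) :+ s)) refl (size Φt) (size Φu) s)
                    (sym (cong (2 +_) Φ≡)))
       (app# e′ Φ′ (unrename u (weaken-injective L) (Φu , refl)))
  where open +-*-Solver

expand-e : {r r′ : Term n} → r ↦e r′ → Expands 0 r r′
expand-e (root-e t L v) Φ with unplug L Φ
... | Δ , s , Ψ , Φ≡ , refill with unsubst (rename (liftʳ (weaken L)) t) Ψ
-- The head entry types `v` with the type of the substituted variable. The other entries are
-- variables typed by themselves, so they add size 0 and their context is `Γₜ ∘ suc`.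
... | Γₜ , j , _ , Φt , _∷_∣_ {j = a} {Δ₁ = Δ₁} Φv Σ e , Ψ≡ with idˢ-inversion Σ
... | e₁ , refl =
  let Γ′ , e′ , Φ′ = refill (≈ᶜ.trans e (≈ᶜ.∙-congˡ {x = Δ₁} e₁))
                       (λ y avoids → rename-support t (proj₁ Φt) (suc y) (liftʳ-avoids avoids)) Φv
  in  resize (trans (solve 3 (λ j a s → j :+ (a :+ s) := (j :+ (a :+ con 0)) :+ s) refl j a s)
                    (sym (trans Φ≡ (cong (_+ s) Ψ≡))))
       (es# (≈ᶜ.trans e′ (≈ᶜ.comm Γ′ (Γₜ ∘ suc ∘ weaken L)))
         (uncons# ≈.refl (unrename t (liftʳ-injective (weaken-injective L)) Φt))
         Φ′)
  where open +-*-Solver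

-- The path to the hole crosses only (@) and (es), which have one premise per immediate subterm: the
-- hole is typed exactly once, at whatever type.
expandᴼ : (O : OpenCtx n k) {c : ℕ} {r r′ : Term k} →
          Expands c r r′ → Expands c (O ⟨ r ⟩ᴼ) (O ⟨ r′ ⟩ᴼ)
expandᴼ ∙        ex Φ = ex Φ
expandᴼ (O ·ˡ t) {c} ex (app Φ Ψ e) =
  resize (trans (cong suc (+-assoc c (size Φ) (size Ψ))) (sym (+-suc c _)))
    (app# e (expandᴼ O ex Φ) (Ψ , refl))
expandᴼ (t ·ʳ O) {c} ex (app Φ Ψ e) =
  resize (trans (cong suc (x∙yz≈y∙xz (size Φ) c (size Ψ))) (sym (+-suc c _)))
    (app# e (Φ , refl) (expandᴼ O ex Ψ))
expandᴼ (O [← t ]ˡ) {c} ex (es Φ Ψ e) =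
  resize (+-assoc c (size Φ) (size Ψ)) (es# e (expandᴼ O ex Φ) (Ψ , refl))
expandᴼ (t [← O ]ʳ) {c} ex (es Φ Ψ e) =
  resize (x∙yz≈y∙xz (size Φ) c (size Ψ)) (es# e (Φ , refl) (expandᴼ O ex Ψ))

mutual
  unitarySolvableˡ-resp-≈ : ∀ {A B} → A ≈ˡ B → UnitarySolvableˡ A → UnitarySolvableˡ B
  unitarySolvableˡ-resp-≈ X       X       = X
  unitarySolvableˡ-resp-≈ (_ ⊸ q) (_ ⊸ U) = _ ⊸ unitarySolvable-resp-≈ q U

  -- Transfers unitarity from the type concluded by a (many) to the list of the types of its
  -- premises.
  unitarySolvable-resp-≈ : ∀ {M N} → M ≈ N → UnitarySolvable M → UnitarySolvable N
  unitarySolvable-resp-≈ (Permutation.refl (e ∷ [])) (single U) =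
    single (unitarySolvableˡ-resp-≈ e U)
  unitarySolvable-resp-≈ {N = _ ∷ []}    (Permutation.prep e p) (single U) =
    single (unitarySolvableˡ-resp-≈ e U)
  unitarySolvable-resp-≈ {N = _ ∷ _ ∷ _} (Permutation.prep e p) (single U) =
    ⊥-elim (PermutationProperties.¬x∷xs↭[] linear-setoid (≈.sym p))
  unitarySolvable-resp-≈ (Permutation.trans p q) U =
    unitarySolvable-resp-≈ q (unitarySolvable-resp-≈ p U)

-- Unitarity is needed to go under an abstraction: it forces a single premise of `many`, so that
-- the body, and hence the redex, is typed exactly once.
expandˢ : (S : SolvingCtx n k) {c : ℕ} {r r′ : Term k} → Expands c r r′ →
          UnitarySolvable N → (Φ : Γ ⊢ S ⟨ r′ ⟩ˢ ∶ N) → Γ ⊢ S ⟨ r ⟩ˢ ∶ N # (c + size Φ)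
expandˢ (open′ O) ex _ Φ = expandᴼ O ex Φ
expandˢ (ƛ S) {c} ex U (many Js Φs Γ≈ M≈) with Js | Φs | Γ≈ | M≈ | unitarySolvable-resp-≈ M≈ U
... | (Γ , _) ∷ [] | lam Φ ∷ [] | Γ≈ | M≈ | single (_ ⊸ U′) =
  conv (≈ᶜ.sym (≈ᶜ.trans Γ≈ (≈ᶜ.identityʳ Γ))) (≈.sym M≈)
    (resize (trans (sym (+-suc c (size Φ))) (cong (c +_) (sym (+-identityʳ _))))
      (single# (lam# (expandˢ S ex U′ Φ))))
expandˢ (S · t) {c} ex U (app Φ Ψ e) =
  resize (trans (cong suc (+-assoc c (size Φ) (size Ψ))) (sym (+-suc c _)))
    -- Unitarity restricts only the right of an arrow, so it passes from the type of the application
    -- to that of the function.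
    (app# e (expandˢ S ex (single (_ ⊸ U)) Φ) (Ψ , refl))
expandˢ (S [← t ]) {c} ex U (es Φ Ψ e) =
  resize (+-assoc c (size Φ) (size Ψ)) (es# e (expandˢ S ex U Φ) (Ψ , refl))

-- Normal forms

-- Phrased by decompositions, with an equation for the plugging, so that normality passes to a
-- subterm by extending the context by one constructor.
OpenNormal : Term n → Set
OpenNormal {n} t = ∀ {k} (O : OpenCtx n k) {r r′} → t ≡ O ⟨ r ⟩ᴼ → ¬ (r ↦m r′ or r ↦e r′)

SolvingNormal : Term n → Set
SolvingNormal {n} t = ∀ {k} (S : SolvingCtx n k) {r r′} → t ≡ S ⟨ r ⟩ˢ → ¬ (r ↦m r′ or r ↦e r′)

InertlyTypable : Term n → Multi → ℕ → Set
InertlyTypable {n} t M k = Σ[ Γ ∈ Ctx n ] (InertCtx Γ × (Γ ⊢ t ∶ M # k))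

inert-⊎ : InertCtx Γ₁ → InertCtx Γ₂ → InertCtx (Γ₁ ⊎ Γ₂)
inert-⊎ I J x = All.++⁺ (I x) (J x)

inert-↪ : (x : Fin n) → Inert M → InertCtx (x ↪ M)
inert-↪ zero    I zero    = I
inert-↪ zero    I (suc y) = []
inert-↪ (suc x) I zero    = []
inert-↪ (suc x) I (suc y) = inert-↪ x I y

-- The derivation for `t` comes first: its inert context fixes the type `Γ zero`, and `u` is then
-- typed with exactly that.
inertlyTypable-es : ∀ {t u} → InertlyTypable t N j → (∀ {M} → Inert M → InertlyTypable u M k) →
                    InertlyTypable {n} (t [← u ]) N (j + k)
inertlyTypable-es (Γ , I , Φ) typable =
  let Δ , J , Ψ = typable (I zero)
  in  Γ ∘ suc ⊎ Δ , inert-⊎ {Γ₁ = Γ ∘ suc} (I ∘ suc) J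
   , es# ≈ᶜ.refl (uncons# ≈.refl Φ) Ψ

-- The two sizes differ only through abstractions in head position, and a neutral term has a
-- variable there. The equation is what lets `solvingTyping` reuse the neutral typing of an
-- application.
data OpenTyping (t : Term n) : Set where
  answer  : (L : SubstCtx n k) (s : Term (suc k)) → t ≡ L ⟨ val (ƛ s) ⟩ᴸ →
            InertlyTypable t [] (openSize t) → OpenTyping t
  neutral : (∀ {M} → Inert M → InertlyTypable t M (openSize t)) →
            solvableSize t ≡ openSize t → OpenTyping t

typable-[] : {t : Term n} → OpenTyping t → InertlyTypable t [] (openSize t)
typable-[] (answer _ _ _ typable) = typable
typable-[] (neutral typable _)    = typable []

openTyping : (t : Term n) → OpenNormal t → OpenTyping t
openTyping (val (var x)) _ = neutral (λ {M} I → x ↪ M , inert-↪ x I , var# x M) refl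
openTyping (val (ƛ t))   _ = answer ∙ t refl (∅ , (λ _ → []) , nil# ≈ᶜ.refl)
openTyping (t · u) normal with openTyping t (λ O e → normal (O ·ˡ u) (cong (_· u) e))
... | answer L s refl _  = ⊥-elim (normal ∙ refl (inj₁ (root-m L s u)))
... | neutral typable t≡ = neutral typable′ (cong (λ s → s + openSize u + 1) t≡)
  where
  typable′ : ∀ {M} → Inert M → InertlyTypable (t · u) M (openSize t + openSize u + 1)
  typable′ I =
    -- The function gets the inert type with zero copies of `X` on the left, so the argument has
    -- only to be typed with `[]`, as answers and neutral terms both can.
    let Γ , J , Φ = typable ((0 ⊸ I) ∷ [])
        Δ , K , Ψ = typable-[] (openTyping u (λ O e → normal (t ·ʳ O) (cong (t ·_) e)))
    in  Γ ⊎ Δ , inert-⊎ {Γ₁ = Γ} J K , resize (+-comm 1 _) (app# ≈ᶜ.refl Φ Ψ)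
openTyping (t [← u ]) normal with openTyping u (λ O e → normal (t [← O ]ʳ) (cong (t [←_]) e))
-- An answer here would be the right part of an e-redex, so `u` is neutral and has every inert type
-- that `t` may require.
... | answer L s refl _ = ⊥-elim (normal ∙ refl (inj₂ (root-e t L (ƛ s))))
... | neutral typable _ with openTyping t (λ O e → normal (O [← u ]ˡ) (cong (_[← u ]) e))
...   | answer L s t≡ typableₜ =
  answer (L [← u ]) s (cong (_[← u ]) t≡) (inertlyTypable-es typableₜ typable)
...   | neutral typableₜ t≡    =
  neutral (λ I → inertlyTypable-es (typableₜ I) typable) (cong (_+ openSize u) t≡)

PreciselyTypable : Term n → ℕ → Set
PreciselyTypable t k = Σ[ N ∈ Multi ] (PreciselySolvable N × InertlyTypable t N k)

ground-precise : PreciselySolvable [ X ]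
ground-precise = single X , z<s , X ∷ []

solvingTyping : (t : Term n) → SolvingNormal t → PreciselyTypable t (solvableSize t)
solvingTyping (val (var x)) _ =
  [ X ] , ground-precise , x ↪ [ X ] , inert-↪ x (X ∷ []) , var# x [ X ]
solvingTyping (val (ƛ t)) normal =
  let N , (U , S) , Γ , I , Φ = solvingTyping t (λ S e → normal (ƛ S) (cong (λ s → val (ƛ s)) e))
  -- The left of the arrow is what the body requires of its variable, inert by `I`; the singleton
  -- gives unitarity.
  in  [ Γ zero ⊸ N ] , (single (Γ zero ⊸ U) , z<s , (I zero ⊸ S) ∷ []) , Γ ∘ suc , I ∘ suc
   , resize (+-comm 1 _)
       (single# (lam# (uncons# ≈.refl Φ)))
solvingTyping (t · u) normal with openTyping (t · u) (λ O → normal (open′ O))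
-- An application is never of the form `L ⟨ val (ƛ s) ⟩ᴸ`, so only the neutral case remains, typed
-- with the ground type.
... | answer ∙ _ () _
... | answer (_ [← _ ]) _ () _
... | neutral typable tu≡ =
  let Γ , I , Φ = typable (X ∷ [])
  in  [ X ] , ground-precise , Γ , I , resize (sym tu≡) Φ
solvingTyping (t [← u ]) normal
  with openTyping u (λ O e → normal (open′ (t [← O ]ʳ)) (cong (t [←_]) e))
... | answer L s refl _ = ⊥-elim (normal (open′ ∙) refl (inj₂ (root-e t L (ƛ s))))
... | neutral typable _ =
  let N , P , typableₜ = solvingTyping t (λ S e → normal (S [← u ]) (cong (_[← u ]) e))
  in  N , P , inertlyTypable-es typableₜ typable

-- Expansion along reduction sequences

normalForm-solvingNormal : {t : Term n} → IsNormalForm _→s_ t → SolvingNormal t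
normalForm-solvingNormal normal S refl (inj₁ step) = normal (_ , inj₁ (close S step))
normalForm-solvingNormal normal S refl (inj₂ step) = normal (_ , inj₂ (close S step))

-- Context and type stay the same at every step, so unitarity of the final type serves for the whole
-- sequence.
expand-→s* : {t u : Term n} (d : t →s* u) → UnitarySolvable N →
             Γ ⊢ u ∶ N # k → Γ ⊢ t ∶ N # (2 * #m d + k)
expand-→s* ε U Φ = Φ
expand-→s* {k = k} (inj₁ (close S step) ◅ d) U Φ =
  let Ψ , s = expand-→s* d U Φ
  in  resize (trans (cong (2 +_) s)
               (trans (sym (+-assoc 2 (2 * #m d) k)) (cong (_+ k) (sym (*-suc 2 (#m d))))))
        (expandˢ S (expand-m step) U Ψ)
expand-→s* (inj₂ (close S step) ◅ d) U Φ =
  let Ψ , s = expand-→s* d U Φ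
  in  resize s (expandˢ S (expand-e step) U Ψ)

theorem9p5 : ∀ {n : ℕ} {t u : Term n} (d : t →s* u) → IsNormalForm _→s_ u →
    Σ[ Γ ∈ Ctx n ] Σ[ N ∈ Multi ] Σ[ Φ ∈ Γ ⊢ t ∶ N ]
    (InertCtx Γ × PreciselySolvable N × 2 * #m d + solvableSize u ≡ size Φ)
theorem9p5 {u = u} d normal =
  let N , P , Γ , I , Ψ = solvingTyping u (normalForm-solvingNormal normal)
      Φ , s = expand-→s* d (proj₁ P) Ψ
  in  Γ , N , Φ , I , P , sym s
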